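{- There is an algorithm which, given synchronized automata (in the Fibonacci numeration system) computing two sequences $(a(n))_{n\ge 0}$ and $(b(n))_{n\ge 0}$ of natural numbers, decides whether $(a(n))_{n \geq 0}$ is a permutation of $(b(n))_{n \geq 0}$, i.e., whether there is a bijection $\sigma:\mathbb{N}\to\mathbb{N}$ with $b(n)=a(\sigma(n))$ for all $n$.
   Context: $\mathbb{N}=\{0,1,2,\ldots\}$. Fibonacci numbers: $F_0=0$, $F_1=1$, $F_n=F_{n-1}+F_{n-2}$. Every $n\in\mathbb{N}$ is written uniquely (Zeckendorf representation) as a bit string $(n)_F=e_1\cdots e_t$ with $e_1\ne 0$, no two consecutive $1$'s, and $n=\sum_{i} e_iF_{t-i+2}$; leading zeros are allowed and ignored. A function $f:\mathbb{N}\to\mathbb{N}$ is (Fibonacci-)synchronized if there is a deterministic finite automaton reading the Fibonacci representations of a pair $(n,x)$ in parallel (most significant digit first, the shorter one padded with leading zeros) that accepts if and only if $x=f(n)$; such an automaton is called a synchronized automaton computing $f$. -}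

module Defs where

open import Data.Nat using (ℕ; zero; suc; _+_; _∸_; _⊔_)
open import Data.Bool using (Bool; true; false; if_then_else_)
open import Data.List using (List; []; _∷_; length; replicate; _++_; zip; foldl)
open import Data.Fin using (Fin)
open import Data.Product using (Σ; _×_)
open import Data.Empty using (⊥)
open import Data.Unit using (⊤)
open import Relation.Binary.PropositionalEquality using (_≡_)
open import Function.Definitions using (Bijective)

fib : ℕ → ℕ
fib zero = 0
fib (suc zero) = 1
fib (suc (suc n)) = fib (suc n) + fib n

-- value of a bit string e_1 ⋯ e_t (most significant first): Σ e_i F_{t-i+2}
fibVal : List Bool → ℕ
fibVal [] = 0
fibVal (b ∷ w) = (if b then fib (length w + 2) else 0) + fibVal w

NoConsec11 : List Bool → Set
NoConsec11 [] = ⊤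
NoConsec11 (true ∷ true ∷ w) = ⊥
NoConsec11 (_ ∷ w) = NoConsec11 w

-- first digit nonzero (empty string allowed: representation of 0)
NoLeadingZero : List Bool → Set
NoLeadingZero [] = ⊤
NoLeadingZero (true ∷ _) = ⊤
NoLeadingZero (false ∷ _) = ⊥

IsZeck : List Bool → ℕ → Set
IsZeck w n = NoLeadingZero w × NoConsec11 w × (fibVal w ≡ n)

padTo : ℕ → List Bool → List Bool
padTo k w = replicate (k ∸ length w) false ++ w

pairUp : List Bool → List Bool → List (Bool × Bool)
pairUp u v = zip (padTo m u) (padTo m v)
  where m = length u ⊔ length v

record DFA : Set where
  field
    nStates : ℕ
    start   : Fin nStates
    step    : Fin nStates → Bool × Bool → Fin nStates
    final   : Fin nStates → Bool

accepts : DFA → List (Bool × Bool) → Bool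
accepts A w = DFA.final A (foldl (DFA.step A) (DFA.start A) w)

Computes : DFA → (ℕ → ℕ) → Set
Computes A f = ∀ n x u v → IsZeck u n → IsZeck v x →
  (accepts A (pairUp u v) ≡ true → x ≡ f n) × (x ≡ f n → accepts A (pairUp u v) ≡ true)

IsPermutationOf : (ℕ → ℕ) → (ℕ → ℕ) → Set
IsPermutationOf a b = Σ (ℕ → ℕ) λ σ → Bijective _≡_ _≡_ σ × (∀ n → b n ≡ a (σ n))

{-# OPTIONS --safe #-}

-- Two sequences are permutations of each other iff every x has the same number of occurrences,
-- possibly infinite, in both.  Make the automaton ignore leading pairs (0,0) and reject words
-- containing 11.  For a word w representing x, the number h(w) of words u of length |w| for which
-- (u,w) is accepted is then the number of occurrences of x below F_{|w|+2}, and the total number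
-- of occurrences of x is the supremum of the nondecreasing sequence h(0^k w).
--
-- The set of states reached by the words first counted at level k + 1 evolves deterministically in
-- k, so it repeats, say at levels i < j.  Hence the supremum is infinite if h(0^i w) < h(0^j w),
-- and equals h(0^i w) otherwise.  Whether it is infinite depends on w through a finite automaton,
-- and h(0^i w) has a linear representation; so each prefix p of w yields an integer vector of
-- bounded dimension which determines the behaviour of every p z.  In a long word some prefix
-- vector depends linearly on the vectors of shorter prefixes, so a comparison of the two sequences
-- that succeeds on all shorter words succeeds on w too.  It therefore suffices to test the words
-- up to an explicit length.
module Submission where

open import Defs
open import Algebra using (AbelianGroup)
open import Data.Bool using (Bool; true; false; if_then_else_; _∧_; _∨_)
open import Data.Fin as Fin using (Fin; zero; suc; punchIn; toℕ; funToFin; finToFun; combine; remQuot)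
import Data.Fin.Properties as Fin
open import Data.Integer as ℤ using (ℤ; 0ℤ; 1ℤ) renaming (+_ to ⁺_)
import Data.Integer.Properties as ℤ
open import Data.Integer.Tactic.RingSolver using (solve-∀)
open import Data.List using (List; []; _∷_; length; _++_; replicate; take; drop; map; cartesianProduct; allFin; zip; foldl)
open import Data.List.Membership.Propositional using (_∈_)
open import Data.List.Membership.Propositional.Properties using (∈-map⁺; ∈-++⁺ˡ; ∈-++⁺ʳ; ∈-allFin; ∈-cartesianProduct⁺)
open import Data.List.Properties using (++-assoc; ++-identityʳ; take++drop≡id; length-++; length-take; length-drop; length-replicate)
open import Data.List.Relation.Unary.Any using (here; there)
open import Data.Maybe using (Maybe; just; nothing)
open import Data.Nat as ℕ using (ℕ; zero; suc; _+_; _*_; _∸_; _^_; _⊔_; _≤_; _<_; z≤n; s≤s)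
open import Data.Nat.Induction using (<-rec; <-wellFounded)
import Data.Nat.Properties as ℕ
open import Data.Product using (Σ; ∃; _×_; _,_; proj₁; proj₂)
open import Data.Product.Properties using (≡-dec)
open import Data.Sum using (_⊎_; inj₁; inj₂)
open import Data.Unit using (tt)
open import Data.Vec.Functional using (insertAt; removeAt)
open import Data.Vec.Functional.Properties using (insertAt-lookup; insertAt-punchIn)
open import Function using (_∘_)
open import Function.Bundles using (Inverse)
open import Function.Definitions using (Injective; Surjective)
open import Induction.WellFounded using (Acc; acc)
open import Relation.Binary.Definitions using (tri<; tri≈; tri>)
open import Relation.Binary.PropositionalEquality
open import Relation.Nullary using (¬_; Dec; yes; no; contradiction; ¬?; _×-dec_; _→-dec_; map′; isYes)
open import Relation.Nullary.Decidable using (decidable-stable)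
open import Algebra.Properties.Group (AbelianGroup.group ℤ.+-0-abelianGroup) using (∙-cancelʳ)
open import Algebra.Properties.Semiring.Sum ℕ.+-*-semiring as ℕ∑ using () renaming (sum to ∑)
open import Algebra.Properties.Semiring.Sum ℤ.+-*-semiring as ℤ∑ using () renaming (sum to ∑ᶻ)

iverson : ∀ {P : Set} → Dec P → ℕ
iverson (yes _) = 1
iverson (no _) = 0

iverson-yes : ∀ {P : Set} (P? : Dec P) → P → iverson P? ≡ 1
iverson-yes (yes _) _ = refl
iverson-yes (no ¬p) p = contradiction p ¬p

iverson-no : ∀ {P : Set} (P? : Dec P) → ¬ P → iverson P? ≡ 0
iverson-no (yes p) ¬p = contradiction p ¬p
iverson-no (no _) _ = refl

-- Rearrangements of sequences

sumBelow : ℕ → (ℕ → ℕ) → ℕ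
sumBelow zero f = 0
sumBelow (suc N) f = sumBelow N f + f N

sumBelow-cong : ∀ N {f g} → (∀ n → n < N → f n ≡ g n) → sumBelow N f ≡ sumBelow N g
sumBelow-cong zero f≗g = refl
sumBelow-cong (suc N) f≗g = cong₂ _+_ (sumBelow-cong N (λ n n<N → f≗g n (ℕ.m<n⇒m<1+n n<N))) (f≗g N ℕ.≤-refl)

sumBelow-+ : ∀ M N f → sumBelow (M + N) f ≡ sumBelow M f + sumBelow N (λ n → f (M + n))
sumBelow-+ M zero f = trans (cong (λ m → sumBelow m f) (ℕ.+-identityʳ M)) (sym (ℕ.+-identityʳ _))
sumBelow-+ M (suc N) f = trans (cong (λ m → sumBelow m f) (ℕ.+-suc M N))
  (trans (cong (_+ f (M + N)) (sumBelow-+ M N f)) (ℕ.+-assoc (sumBelow M f) _ _))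

sumBelow-mono : ∀ {M N} f → M ≤ N → sumBelow M f ≤ sumBelow N f
sumBelow-mono {M} {N} f M≤N = subst (λ K → sumBelow M f ≤ sumBelow K f) (ℕ.m+[n∸m]≡n M≤N)
  (ℕ.≤-trans (ℕ.m≤m+n _ _) (ℕ.≤-reflexive (sym (sumBelow-+ M (N ℕ.∸ M) f))))

-- Deletes one summand, so that the values of an injection can be removed from a sum one at a time.
except : ℕ → (ℕ → ℕ) → ℕ → ℕ
except p f n = if isYes (n ℕ.≟ p) then 0 else f n

except-≢ : ∀ p f {n} → n ≢ p → except p f n ≡ f n
except-≢ p f {n} n≢p with n ℕ.≟ p
... | yes n≡p = contradiction n≡p n≢p
... | no _ = refl

sumBelow-except : ∀ N f {p} → p < N → sumBelow N f ≡ sumBelow N (except p f) + f p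
sumBelow-except (suc N) f {p} (s≤s p≤N) with N ℕ.≟ p
... | yes refl = cong (_+ f N) (trans (sumBelow-cong N (λ n n<N → sym (except-≢ N f (ℕ.<⇒≢ n<N)))) (sym (ℕ.+-identityʳ _)))
... | no N≢p = begin
  sumBelow N f + f N                         ≡⟨ cong (_+ f N) (sumBelow-except N f (ℕ.≤∧≢⇒< p≤N (N≢p ∘ sym))) ⟩
  sumBelow N (except p f) + f p + f N        ≡⟨ ℕ.+-assoc (sumBelow N (except p f)) (f p) (f N) ⟩
  sumBelow N (except p f) + (f p + f N)      ≡⟨ cong (sumBelow N (except p f) +_) (ℕ.+-comm (f p) (f N)) ⟩
  sumBelow N (except p f) + (f N + f p)      ≡⟨ ℕ.+-assoc (sumBelow N (except p f)) (f N) (f p) ⟨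
  sumBelow N (except p f) + f N + f p        ∎
  where open ≡-Reasoning

-- Induction on `N` for all `f` at once: the term at `σ N` is split off and zeroed in `f`, which by
-- injectivity leaves the earlier terms unchanged.
sumBelow-injective : ∀ {σ : ℕ → ℕ} → Injective _≡_ _≡_ σ → ∀ N f {N′} → (∀ n → n < N → σ n < N′) →
  sumBelow N (f ∘ σ) ≤ sumBelow N′ f
sumBelow-injective inj zero f below = z≤n
sumBelow-injective {σ} inj (suc N) f {N′} below = begin
  sumBelow N (f ∘ σ) + f (σ N)
    ≡⟨ cong (_+ f (σ N)) (sumBelow-cong N (λ n n<N → sym (except-≢ (σ N) f (λ eq → ℕ.<⇒≢ n<N (inj eq))))) ⟩
  sumBelow N (except (σ N) f ∘ σ) + f (σ N)
    ≤⟨ ℕ.+-monoˡ-≤ (f (σ N)) (sumBelow-injective inj N (except (σ N) f) (λ n n<N → below n (ℕ.m<n⇒m<1+n n<N))) ⟩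
  sumBelow N′ (except (σ N) f) + f (σ N)
    ≡⟨ sumBelow-except N′ f (below N ℕ.≤-refl) ⟨
  sumBelow N′ f ∎
  where open ℕ.≤-Reasoning

bounded-below : ∀ (σ : ℕ → ℕ) N → ∃ λ N′ → ∀ n → n < N → σ n < N′
bounded-below σ zero = 0 , λ _ ()
bounded-below σ (suc N) =
  let N′ , below = bounded-below σ N in
  N′ ⊔ suc (σ N) , λ n n<1+N → case n below (ℕ.m≤n⇒m<n∨m≡n (ℕ.≤-pred n<1+N))
  where
  case : ∀ n {N′} → (∀ n → n < N → σ n < N′) → n < N ⊎ n ≡ N → σ n < N′ ⊔ suc (σ N)
  case n below (inj₁ n<N) = ℕ.≤-trans (below n n<N) (ℕ.m≤m⊔n _ _)
  case n {N′} below (inj₂ refl) = ℕ.m≤n⊔m N′ (suc (σ N))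

occurrences : (ℕ → ℕ) → ℕ → ℕ → ℕ
occurrences a x N = sumBelow N (λ n → iverson (a n ℕ.≟ x))

occurrences-hit : ∀ a {x n} → a n ≡ x → occurrences a x (suc n) ≡ suc (occurrences a x n)
occurrences-hit a {x} {n} an≡x = trans (cong (occurrences a x n +_) (iverson-yes (a n ℕ.≟ x) an≡x)) (ℕ.+-comm _ 1)

nth-occurrence : ∀ a x N {r} → r < occurrences a x N → ∃ λ n → a n ≡ x × occurrences a x n ≡ r
nth-occurrence a x (suc N) {r} r< with a N ℕ.≟ x
... | no _ = nth-occurrence a x N (subst (r <_) (ℕ.+-identityʳ _) r<)
... | yes aN≡x with ℕ.m≤n⇒m<n∨m≡n (ℕ.≤-pred (subst (r <_) (ℕ.+-comm _ 1) r<))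
...   | inj₁ r<N = nth-occurrence a x N r<N
...   | inj₂ r≡ = N , aN≡x , sym r≡

-- The running count jumps right after each occurrence, so the number of earlier occurrences (the
-- rank) pins down the index.
occurrence-unique : ∀ a {x m n} → a m ≡ x → a n ≡ x → occurrences a x m ≡ occurrences a x n → m ≡ n
occurrence-unique a {x} {m} {n} am≡x an≡x eq with ℕ.<-cmp m n
... | tri≈ _ m≡n _ = m≡n
... | tri< m<n _ _ = contradiction eq (ℕ.<⇒≢ (ℕ.≤-trans (ℕ.≤-reflexive (sym (occurrences-hit a am≡x))) (sumBelow-mono _ m<n)))
... | tri> _ _ n<m = contradiction (sym eq) (ℕ.<⇒≢ (ℕ.≤-trans (ℕ.≤-reflexive (sym (occurrences-hit a an≡x))) (sumBelow-mono _ n<m)))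

-- Compares total multiplicities, which may be infinite, through finite initial segments only;
-- nothing has to be known about which values recur forever.
_≼_ : (ℕ → ℕ) → (ℕ → ℕ) → Set
a ≼ b = ∀ x N → ∃ λ N′ → occurrences a x N ≤ occurrences b x N′

-- Sends each occurrence of a value in `a` to the occurrence of that value in `b` with the same
-- rank.
matching : ∀ {a b} → a ≼ b → ∀ n → ∃ λ m → b m ≡ a n × occurrences b (a n) m ≡ occurrences a (a n) n
matching {a} {b} a≼b n =
  let N′ , le = a≼b (a n) (suc n)
  in nth-occurrence b (a n) N′ (ℕ.≤-trans (ℕ.≤-reflexive (sym (occurrences-hit a refl))) le)

≼⇒permutation : ∀ {a b} → a ≼ b → b ≼ a → IsPermutationOf a b
≼⇒permutation {a} {b} a≼b b≼a = σ , (σ-injective , σ-surjective) , λ n → sym (value n)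
  where
  σ : ℕ → ℕ
  σ n = proj₁ (matching b≼a n)
  value : ∀ n → a (σ n) ≡ b n
  value n = proj₁ (proj₂ (matching b≼a n))
  rank : ∀ n → occurrences a (b n) (σ n) ≡ occurrences b (b n) n
  rank n = proj₂ (proj₂ (matching b≼a n))
  σ-injective : Injective _≡_ _≡_ σ
  σ-injective {m} {n} σm≡σn = occurrence-unique b bm≡bn refl (begin
    occurrences b (b n) m      ≡⟨ cong (λ x → occurrences b x m) bm≡bn ⟨
    occurrences b (b m) m      ≡⟨ rank m ⟨
    occurrences a (b m) (σ m)  ≡⟨ cong₂ (occurrences a) bm≡bn σm≡σn ⟩
    occurrences a (b n) (σ n)  ≡⟨ rank n ⟩
    occurrences b (b n) n      ∎)
    where
    open ≡-Reasoning
    bm≡bn : b m ≡ b n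
    bm≡bn = trans (sym (value m)) (trans (cong a σm≡σn) (value n))
  σ-surjective : Surjective _≡_ _≡_ σ
  σ-surjective m =
    -- The preimage comes from the matching in the opposite direction; `σ n` and `m` are then
    -- occurrences of the same value with the same rank.
    let n , bn≡am , occ = matching a≼b m in
    n , λ { refl → occurrence-unique a (trans (value n) bn≡am) refl
          (trans (subst (λ x → occurrences a x (σ n) ≡ occurrences b x n) bn≡am (rank n)) occ) }

reindexed⇒≼ : ∀ {a b} (σ : ℕ → ℕ) → Injective _≡_ _≡_ σ → (∀ n → a n ≡ b (σ n)) → a ≼ b
reindexed⇒≼ {a} {b} σ inj a≗bσ x N =
  let N′ , below = bounded-below σ N in
  N′ , ℕ.≤-trans (ℕ.≤-reflexive (sumBelow-cong N (λ n _ → cong (λ y → iverson (y ℕ.≟ x)) (a≗bσ n))))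
                 (sumBelow-injective inj N (λ m → iverson (b m ℕ.≟ x)) below)

permutation⇒≼ : ∀ {a b} → IsPermutationOf a b → a ≼ b × b ≼ a
permutation⇒≼ {a} {b} (σ , (inj , surj) , b≗aσ) =
  reindexed⇒≼ σ⁻¹ σ⁻¹-injective (λ n → trans (cong a (sym (right n))) (sym (b≗aσ (σ⁻¹ n)))) , reindexed⇒≼ σ inj b≗aσ
  where
  σ⁻¹ : ℕ → ℕ
  σ⁻¹ n = proj₁ (surj n)
  right : ∀ n → σ (σ⁻¹ n) ≡ n
  right n = proj₂ (surj n) refl
  σ⁻¹-injective : Injective _≡_ _≡_ σ⁻¹
  σ⁻¹-injective {m} {n} eq = trans (sym (right m)) (trans (cong σ eq) (right n))

-- Linear dependence over ℤ

∑ᶻ-zero : ∀ {n} {f : Fin n → ℤ} → (∀ i → f i ≡ 0ℤ) → ∑ᶻ f ≡ 0ℤ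
∑ᶻ-zero {n} f≗0 = trans (ℤ∑.sum-cong-≗ f≗0) (ℤ∑.sum-replicate-zero n)

∑ᶻ-cancel : ∀ {n} {f g : Fin n → ℤ} i → ∑ᶻ f ≡ ∑ᶻ g → (∀ j → j ≢ i → f j ≡ g j) → f i ≡ g i
∑ᶻ-cancel {suc n} {f} {g} i ∑f≡∑g f≗g =
  ∙-cancelʳ (∑ᶻ (removeAt g i)) (f i) (g i) (begin
    f i ℤ.+ ∑ᶻ (removeAt g i)  ≡⟨ cong (λ u → f i ℤ.+ u) (ℤ∑.sum-cong-≗ (λ j → f≗g _ (Fin.punchInᵢ≢i i j))) ⟨
    f i ℤ.+ ∑ᶻ (removeAt f i)  ≡⟨ ℤ∑.sum-remove f ⟨
    ∑ᶻ f                       ≡⟨ ∑f≡∑g ⟩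
    ∑ᶻ g                       ≡⟨ ℤ∑.sum-remove g ⟩
    g i ℤ.+ ∑ᶻ (removeAt g i)  ∎)
  where open ≡-Reasoning

-- Fraction-free Gaussian elimination, one coordinate of `ks` at a time. A coordinate on which all
-- vectors vanish is dropped; otherwise one vector serves as pivot and is eliminated from the
-- others.
linear-dependence : ∀ {K : Set} (ks : List K) {m} (x : Fin m → K → ℤ) → length ks ℕ.< m →
  ∃ λ (c : Fin m → ℤ) → (∃ λ i → c i ≢ 0ℤ) × (∀ {k} → k ∈ ks → ∑ᶻ (λ i → c i ℤ.* x i k) ≡ 0ℤ)
linear-dependence [] {suc m} x _ = (λ _ → 1ℤ) , (zero , λ ()) , λ ()
linear-dependence (k ∷ ks) {suc m} x (ℕ.s≤s ks<m) with Fin.any? (λ i → ¬? (x i k ℤ.≟ 0ℤ))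
... | no all-zero =
  let c , c≢0 , rel = linear-dependence ks x (ℕ.m≤n⇒m≤1+n ks<m) in
  c , c≢0 , λ where
    (here refl) → ∑ᶻ-zero λ i →
      trans (cong (c i ℤ.*_) (decidable-stable (x i k ℤ.≟ 0ℤ) (λ x≢0 → all-zero (i , x≢0)))) (ℤ.*-zeroʳ (c i))
    (there k∈ks) → rel k∈ks
... | yes (p , pivot≢0) = C , (punchIn p (proj₁ c≢0) , C≢0) , λ where
    (here refl) → trans (C-relation k) (∑ᶻ-zero λ j → trans (cong (c j ℤ.*_) (y-pivot j)) (ℤ.*-zeroʳ (c j)))
    (there k∈ks) → trans (C-relation _) (rel k∈ks)
  where
  -- Cross-multiplication with the pivot row makes coordinate `k` vanish without division.
  y : Fin m → _ → ℤ
  y j κ = x p k ℤ.* x (punchIn p j) κ ℤ.- x (punchIn p j) k ℤ.* x p κ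
  IH = linear-dependence ks y ks<m
  c = proj₁ IH
  c≢0 = proj₁ (proj₂ IH)
  rel = proj₂ (proj₂ IH)
  s = ∑ᶻ (λ j → c j ℤ.* x (punchIn p j) k)
  -- Collecting the terms of the relation among the `y j` gives the pivot vector the coefficient
  -- `- s` and scales every other coefficient by the nonzero pivot.
  C : Fin (suc m) → ℤ
  C = insertAt (λ j → c j ℤ.* x p k) p (ℤ.- s)
  y-pivot : ∀ j → y j k ≡ 0ℤ
  y-pivot j = trans (cong (ℤ._- x (punchIn p j) k ℤ.* x p k) (ℤ.*-comm (x p k) _)) (ℤ.+-inverseʳ (x (punchIn p j) k ℤ.* x p k))
  C≢0 : C (punchIn p (proj₁ c≢0)) ≢ 0ℤ
  C≢0 eq with ℤ.i*j≡0⇒i≡0∨j≡0 _ (trans (sym (insertAt-punchIn _ p _ (proj₁ c≢0))) eq)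
  ... | inj₁ c≡0 = proj₂ c≢0 c≡0
  ... | inj₂ x≡0 = pivot≢0 x≡0
  C-relation : ∀ κ → ∑ᶻ (λ i → C i ℤ.* x i κ) ≡ ∑ᶻ (λ j → c j ℤ.* y j κ)
  C-relation κ = begin
    ∑ᶻ (λ i → C i ℤ.* x i κ)
      ≡⟨ ℤ∑.sum-remove {i = p} (λ i → C i ℤ.* x i κ) ⟩
    C p ℤ.* x p κ ℤ.+ ∑ᶻ (λ j → C (punchIn p j) ℤ.* x (punchIn p j) κ)
      ≡⟨ cong₂ (λ u v → u ℤ.* x p κ ℤ.+ v) (insertAt-lookup _ p _)
           (ℤ∑.sum-cong-≗ (λ j → cong (ℤ._* x (punchIn p j) κ) (insertAt-punchIn _ p _ j))) ⟩
    ℤ.- s ℤ.* x p κ ℤ.+ ∑ᶻ (λ j → c j ℤ.* x p k ℤ.* x (punchIn p j) κ)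
      ≡⟨ cong (λ u → u ℤ.+ ∑ᶻ (λ j → c j ℤ.* x p k ℤ.* x (punchIn p j) κ))
           (trans (swap-sign s (x p κ)) (ℤ∑.*-distribʳ-sum (ℤ.- x p κ) (λ j → c j ℤ.* x (punchIn p j) k))) ⟩
    ∑ᶻ (λ j → c j ℤ.* x (punchIn p j) k ℤ.* ℤ.- x p κ) ℤ.+ ∑ᶻ (λ j → c j ℤ.* x p k ℤ.* x (punchIn p j) κ)
      ≡⟨ ℤ∑.∑-distrib-+ (λ j → c j ℤ.* x (punchIn p j) k ℤ.* ℤ.- x p κ) _ ⟨
    ∑ᶻ (λ j → c j ℤ.* x (punchIn p j) k ℤ.* ℤ.- x p κ ℤ.+ c j ℤ.* x p k ℤ.* x (punchIn p j) κ)
      ≡⟨ ℤ∑.sum-cong-≗ (λ j → expand (c j) (x (punchIn p j) k) (x p κ) (x p k) (x (punchIn p j) κ)) ⟩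
    ∑ᶻ (λ j → c j ℤ.* y j κ) ∎
    where
    open ≡-Reasoning
    swap-sign : ∀ a b → ℤ.- a ℤ.* b ≡ a ℤ.* ℤ.- b
    swap-sign = solve-∀
    expand : ∀ c u v w z → c ℤ.* u ℤ.* ℤ.- v ℤ.+ c ℤ.* w ℤ.* z ≡ c ℤ.* (w ℤ.* z ℤ.- u ℤ.* v)
    expand = solve-∀

last-nonzero : ∀ {m} (c : Fin m → ℤ) → (∃ λ i → c i ≢ 0ℤ) →
  ∃ λ i → c i ≢ 0ℤ × (∀ j → i Fin.< j → c j ≡ 0ℤ)
last-nonzero {suc m} c (i , ci≢0) with Fin.any? (λ j → ¬? (c (suc j) ℤ.≟ 0ℤ))
... | yes later =
  let j , cj≢0 , after = last-nonzero (c ∘ suc) later in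
  suc j , cj≢0 , λ { (suc k) (ℕ.s≤s j<k) → after k j<k }
... | no none = zero , c0≢0 i ci≢0 , λ { (suc k) _ → c-suc k }
  where
  c-suc : ∀ k → c (suc k) ≡ 0ℤ
  c-suc k = decidable-stable (c (suc k) ℤ.≟ 0ℤ) (λ ck≢0 → none (k , ck≢0))
  c0≢0 : ∀ i → c i ≢ 0ℤ → c zero ≢ 0ℤ
  c0≢0 zero ci≢0 = ci≢0
  c0≢0 (suc k) ci≢0 = contradiction (c-suc k) ci≢0

-- Singling out the last nonzero coefficient makes one vector dependent on earlier ones alone; for
-- prefixes of a word, on shorter ones.
last-dependent : ∀ {K : Set} (ks : List K) {m} (x : Fin m → K → ℤ) → length ks ℕ.< m →
  ∃ λ (c : Fin m → ℤ) → ∃ λ i → c i ≢ 0ℤ × (∀ j → i Fin.< j → c j ≡ 0ℤ) ×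
    (∀ {k} → k ∈ ks → ∑ᶻ (λ i → c i ℤ.* x i k) ≡ 0ℤ)
last-dependent ks x ks<m =
  let c , c≢0 , rel = linear-dependence ks x ks<m
      i , ci≢0 , after = last-nonzero c c≢0
  in c , i , ci≢0 , after , rel

-- Counting accepted first components of a given second component

∑-pos⁺ : ∀ {n} {f : Fin n → ℕ} i → 0 < f i → 0 < ∑ f
∑-pos⁺ zero 0<f = ℕ.≤-trans 0<f (ℕ.m≤m+n _ _)
∑-pos⁺ {f = f} (suc i) 0<f = ℕ.≤-trans (∑-pos⁺ i 0<f) (ℕ.m≤n+m _ (f zero))

∑-pos⁻ : ∀ {n} (f : Fin n → ℕ) → 0 < ∑ f → ∃ λ i → 0 < f i
∑-pos⁻ {suc n} f 0<∑ with f zero in f0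
... | suc _ = zero , subst (0 <_) (sym f0) (s≤s z≤n)
... | zero = let i , 0<f = ∑-pos⁻ (f ∘ suc) 0<∑ in suc i , 0<f

∑-iverson : ∀ {n} (s : Fin n) (g : Fin n → ℕ) → ∑ (λ t → iverson (s Fin.≟ t) * g t) ≡ g s
∑-iverson {suc n} s g = begin
  ∑ (λ t → iverson (s Fin.≟ t) * g t)
    ≡⟨ ℕ∑.sum-remove {i = s} (λ t → iverson (s Fin.≟ t) * g t) ⟩
  iverson (s Fin.≟ s) * g s + ∑ (λ j → iverson (s Fin.≟ punchIn s j) * g (punchIn s j))
    ≡⟨ cong₂ _+_ (trans (cong (_* g s) (iverson-yes (s Fin.≟ s) refl)) (ℕ.+-identityʳ (g s)))
         (trans (ℕ∑.sum-cong-≗ λ j → cong (_* g (punchIn s j)) (iverson-no (s Fin.≟ punchIn s j) (λ s≡ → Fin.punchInᵢ≢i s j (sym s≡))))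
                (ℕ∑.sum-replicate-zero n)) ⟩
  g s + 0
    ≡⟨ ℕ.+-identityʳ (g s) ⟩
  g s ∎
  where open ≡-Reasoning

bit : ℕ → Fin 2
bit zero = zero
bit (suc _) = suc zero

-- The zero pattern, coded as an element of a finite type so that the pigeonhole principle and
-- decidable equality apply.
support : ∀ {n} → (Fin n → ℕ) → Fin (2 ^ n)
support α = funToFin (bit ∘ α)

support-pos : ∀ {n} {α β : Fin n → ℕ} → support α ≡ support β → ∀ t → 0 < α t → 0 < β t
support-pos {α = α} {β} eq t 0<αt = bit-pos 0<αt (begin
  bit (α t)                     ≡⟨ Fin.finToFun-funToFin (bit ∘ α) t ⟨
  finToFun (support α) t        ≡⟨ cong (λ c → finToFun c t) eq ⟩
  finToFun (support β) t        ≡⟨ Fin.finToFun-funToFin (bit ∘ β) t ⟩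
  bit (β t) ∎)
  where
  open ≡-Reasoning
  bit-pos : ∀ {m n} → 0 < m → bit m ≡ bit n → 0 < n
  bit-pos {suc m} {suc n} _ _ = s≤s z≤n

-- A sum of naturals is positive exactly when some term is, and positivity of a product sees only
-- whether its factors vanish.
∑*-support : ∀ {n} {α β : Fin n → ℕ} (g : Fin n → ℕ) → support α ≡ support β →
  0 < ∑ (λ t → α t * g t) → 0 < ∑ (λ t → β t * g t)
∑*-support {α = α} {β} g eq 0<∑ with ∑-pos⁻ (λ t → α t * g t) 0<∑
... | t , 0<αg = ∑-pos⁺ t (pos (α t) (support-pos {α = α} {β} eq t) 0<αg)
  where
  pos : ∀ a {b c} → (0 < a → 0 < b) → 0 < a * c → 0 < b * c
  pos (suc a) {b} {zero} _ 0<ac = contradiction (subst (0 <_) (ℕ.*-zeroʳ a) 0<ac) (λ ())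
  pos (suc a) {b} {suc c} 0<b _ = ℕ.*-mono-≤ (0<b (s≤s z≤n)) (s≤s z≤n)

-- Nondecreasing sequences whose positive increments recur periodically

module Increments (h e : ℕ → ℕ) (h-suc : ∀ k → h (suc k) ≡ h k + e k) where

  h-+ : ∀ k m → h k ≤ h (m + k)
  h-+ k zero = ℕ.≤-refl
  h-+ k (suc m) = ℕ.≤-trans (h-+ k m) (ℕ.≤-trans (ℕ.m≤m+n _ _) (ℕ.≤-reflexive (sym (h-suc (m + k)))))

  h-mono : ∀ {k l} → k ≤ l → h k ≤ h l
  h-mono {k} {l} k≤l = subst (λ m → h k ≤ h m) (ℕ.m∸n+n≡m k≤l) (h-+ k (l ∸ k))

  growth : ∀ k m → h k < h (m + k) → ∃ λ i → i < m × 0 < e (i + k)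
  growth k zero h<h = contradiction h<h (ℕ.<-irrefl refl)
  growth k (suc m) h<h with e (m + k) in em
  ... | suc _ = m , ℕ.≤-refl , subst (0 <_) (sym em) (s≤s z≤n)
  ... | zero =
    let i , i<m , 0<e = growth k m (subst (h k <_) (trans (h-suc (m + k)) (trans (cong (_ +_) em) (ℕ.+-identityʳ _))) h<h)
    in i , ℕ.m<n⇒m<1+n i<m , 0<e

  increment : ∀ {k} → 0 < e k → h k < h (suc k)
  increment {k} 0<e = subst (h k <_) (sym (h-suc k)) (ℕ.m<m+n (h k) 0<e)

  module Periodic (start period : ℕ) (0<period : 0 < period)
    (forth : ∀ k → 0 < e (k + start) → 0 < e (k + period + start))
    (back : ∀ k → 0 < e (k + period + start) → 0 < e (k + start)) where

    -- A rise within the first period contains a positive increment, which recurs after every period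
    -- and adds at least 1 each time.
    unbounded : h start < h (period + start) → ∀ n → ∃ λ k → n ≤ h k
    unbounded h<h n =
      let i , _ , 0<e = growth start period h<h
          j , _ , n≤h = climb i 0<e n
      in suc (j + start) , n≤h
      where
      climb : ∀ i → 0 < e (i + start) → ∀ n → ∃ λ j → 0 < e (j + start) × n ≤ h (suc (j + start))
      climb i 0<e zero = i , 0<e , z≤n
      climb i 0<e (suc n) with climb i 0<e n
      ... | j , 0<ej , n≤h = j + period , forth j 0<ej ,
        ℕ.≤-trans (s≤s (ℕ.≤-trans n≤h (h-mono (ℕ.+-monoˡ-≤ start (ℕ.m<m+n j 0<period))))) (increment (forth j 0<ej))

    -- A positive increment anywhere after `start` could be moved back by whole periods into the
    -- first one, where there is none.
    bounded : ¬ h start < h (period + start) → ∀ k → h k ≤ h start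
    bounded h≮h k with h start ℕ.<? h (k + start)
    ... | no h≮hk = ℕ.≤-trans (h-mono (ℕ.m≤m+n k start)) (ℕ.≮⇒≥ h≮hk)
    ... | yes h<hk = let i , _ , 0<e = growth start k h<hk in contradiction 0<e (none i)
      where
      none : ∀ i → ¬ 0 < e (i + start)
      none = <-rec _ λ i rec 0<e → case-period i rec 0<e (ℕ.<-≤-connex i period)
        where
        case-period : ∀ i → (∀ {j} → j < i → ¬ 0 < e (j + start)) → 0 < e (i + start) → ¬ (i < period ⊎ period ≤ i)
        case-period i rec 0<e (inj₁ i<p) = h≮h (ℕ.≤-<-trans (h-mono (ℕ.m≤n+m start i))
          (ℕ.<-≤-trans (increment 0<e) (h-mono (ℕ.+-monoˡ-≤ start i<p))))
        case-period i rec 0<e (inj₂ p≤i) = rec (ℕ.∸-monoʳ-< 0<period p≤i)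
          (back (i ∸ period) (subst (λ j → 0 < e (j + start)) (sym (ℕ.m∸n+n≡m p≤i)) 0<e))

-- Path counts of an automaton on words padded with zeros

zeros : ℕ → List Bool
zeros k = replicate k false

zeros-+ : ∀ k l w → zeros (k + l) ++ w ≡ zeros l ++ zeros k ++ w
zeros-+ k zero w = cong (λ m → zeros m ++ w) (ℕ.+-identityʳ k)
zeros-+ k (suc l) w = trans (cong (λ m → zeros m ++ w) (ℕ.+-suc k l)) (cong (false ∷_) (zeros-+ k l w))

module Runs (M : DFA) (zero-loop : DFA.step M (DFA.start M) (false , false) ≡ DFA.start M) where
  open DFA M

  -- Reads `w` as second component and sums the weight `f` of the final state over all first
  -- components of the same length. The weight `accepting` counts accepted words, `reaching t`
  -- counts paths to `t`.
  runs : (Fin nStates → ℕ) → Fin nStates → List Bool → ℕ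
  runs f s [] = f s
  runs f s (b ∷ w) = runs f (step s (false , b)) w + runs f (step s (true , b)) w

  reaching : Fin nStates → Fin nStates → ℕ
  reaching t s = iverson (s Fin.≟ t)

  -- The linear representation: the prefix contributes a vector of path counts indexed by the
  -- intermediate state, the suffix a linear functional on it.
  runs-++ : ∀ f s p z → runs f s (p ++ z) ≡ ∑ (λ t → runs (reaching t) s p * runs f t z)
  runs-++ f s [] z = sym (∑-iverson s (λ t → runs f t z))
  runs-++ f s (b ∷ p) z = begin
    runs f s₀ (p ++ z) + runs f s₁ (p ++ z)
      ≡⟨ cong₂ _+_ (runs-++ f s₀ p z) (runs-++ f s₁ p z) ⟩
    ∑ (λ t → runs (reaching t) s₀ p * runs f t z) + ∑ (λ t → runs (reaching t) s₁ p * runs f t z)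
      ≡⟨ ℕ∑.∑-distrib-+ (λ t → runs (reaching t) s₀ p * runs f t z) _ ⟨
    ∑ (λ t → runs (reaching t) s₀ p * runs f t z + runs (reaching t) s₁ p * runs f t z)
      ≡⟨ ℕ∑.sum-cong-≗ (λ t → ℕ.*-distribʳ-+ (runs f t z) (runs (reaching t) s₀ p) _) ⟨
    ∑ (λ t → runs (reaching t) s (b ∷ p) * runs f t z) ∎
    where
    open ≡-Reasoning
    s₀ = step s (false , b)
    s₁ = step s (true , b)

  accepting : Fin nStates → ℕ
  accepting s = if final s then 1 else 0

  level : (Fin nStates → ℕ) → ℕ → List Bool → ℕ
  level f k w = runs f start (zeros k ++ w)

  -- The part of level `suc k` whose first component begins with 1. The part beginning with 0 is
  -- level `k` again, since the start state loops on `(false , false)`.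
  fresh : (Fin nStates → ℕ) → ℕ → List Bool → ℕ
  fresh f k w = runs f (step start (true , false)) (zeros k ++ w)

  level-suc : ∀ f w k → level f (suc k) w ≡ level f k w + fresh f k w
  level-suc f w k = cong (λ s → runs f s (zeros k ++ w) + fresh f k w) zero-loop

  level-mono : ∀ f w {k l} → k ≤ l → level f k w ≤ level f l w
  level-mono f w = Increments.h-mono (λ k → level f k w) (λ k → fresh f k w) (level-suc f w)

  level-++ : ∀ f k p z → level f k (p ++ z) ≡ ∑ (λ t → level (reaching t) k p * runs f t z)
  level-++ f k p z = trans (cong (runs f start) (sym (++-assoc (zeros k) p z))) (runs-++ f start (zeros k ++ p) z)

  freshSupport : ℕ → Fin (2 ^ nStates)
  freshSupport k = support (λ t → fresh (reaching t) k [])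

  -- After the leading 1 and `i` zeros only the set of reached states matters for positivity; the
  -- remaining `k` zeros and `w` are the same input in both cases.
  fresh-transfer : ∀ i j → freshSupport i ≡ freshSupport j →
    ∀ f w k → 0 < fresh f (k + i) w → 0 < fresh f (k + j) w
  fresh-transfer i j eq f w k 0<fresh =
    subst (0 <_) (sym (split j)) (∑*-support (λ t → runs f t (zeros k ++ w)) eq (subst (0 <_) (split i) 0<fresh))
    where
    split : ∀ i → fresh f (k + i) w ≡ ∑ (λ t → fresh (reaching t) i [] * runs f t (zeros k ++ w))
    split i = trans (cong (runs f _) (trans (zeros-+ k i w) (sym (cong (_++ zeros k ++ w) (++-identityʳ (zeros i))))))
                    (runs-++ f _ (zeros i ++ []) (zeros k ++ w))

  abstract
    repetition : ∃ λ i → ∃ λ j → i < j × freshSupport i ≡ freshSupport j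
    repetition =
      let i , j , i<j , eq = Fin.pigeonhole (ℕ.n<1+n (2 ^ nStates)) (freshSupport ∘ toℕ)
      in toℕ i , toℕ j , i<j , eq

  stableLevel laterLevel period : ℕ
  stableLevel = proj₁ repetition
  laterLevel = proj₁ (proj₂ repetition)
  period = laterLevel ∸ stableLevel

  private
    stable<later : stableLevel < laterLevel
    stable<later = proj₁ (proj₂ (proj₂ repetition))

    period+stable : period + stableLevel ≡ laterLevel
    period+stable = ℕ.m∸n+n≡m (ℕ.<⇒≤ stable<later)

    shift : ∀ k → k + period + stableLevel ≡ k + laterLevel
    shift k = trans (ℕ.+-assoc k period stableLevel) (cong (k +_) period+stable)

  -- The growth of all levels is decided by comparing two of them, since positivity of the
  -- increments repeats with period `laterLevel - stableLevel`.
  Unbounded : List Bool → Set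
  Unbounded w = level accepting stableLevel w < level accepting laterLevel w

  stableCount : List Bool → ℕ
  stableCount = level accepting stableLevel

  module _ (w : List Bool) where
    private
      open module I = Increments (λ k → level accepting k w) (λ k → fresh accepting k w) (level-suc accepting w)
      open module P = I.Periodic stableLevel period (ℕ.m<n⇒0<n∸m stable<later)
        (λ k 0<e → subst (λ m → 0 < fresh accepting m w) (sym (shift k))
                     (fresh-transfer _ _ (proj₂ (proj₂ (proj₂ repetition))) accepting w k 0<e))
        (λ k 0<e → fresh-transfer _ _ (sym (proj₂ (proj₂ (proj₂ repetition)))) accepting w k
                     (subst (λ m → 0 < fresh accepting m w) (shift k) 0<e))

    Unbounded⇒unbounded : Unbounded w → ∀ n → ∃ λ k → n ≤ level accepting k w
    Unbounded⇒unbounded u = P.unbounded (subst (λ m → level accepting stableLevel w < level accepting m w) (sym period+stable) u)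

    ¬Unbounded⇒bounded : ¬ Unbounded w → ∀ k → level accepting k w ≤ stableCount w
    ¬Unbounded⇒bounded ¬u = P.bounded (¬u ∘ subst (λ m → level accepting stableLevel w < level accepting m w) period+stable)

  -- The growth between the two levels, split by the state reached after the prefix. Levels are
  -- monotone, so the truncated subtraction loses nothing.
  gap : List Bool → Fin nStates → ℕ
  gap p t = level (reaching t) laterLevel p ∸ level (reaching t) stableLevel p

  class : List Bool → Fin (2 ^ nStates)
  class p = support (gap p)

  laterLevel-++ : ∀ p z →
    level accepting laterLevel (p ++ z) ≡ stableCount (p ++ z) + ∑ (λ t → gap p t * runs accepting t z)
  laterLevel-++ p z = begin
    level accepting laterLevel (p ++ z)
      ≡⟨ level-++ accepting laterLevel p z ⟩
    ∑ (λ t → level (reaching t) laterLevel p * runs accepting t z)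
      ≡⟨ ℕ∑.sum-cong-≗ (λ t → cong (_* runs accepting t z) (ℕ.m+[n∸m]≡n (level-mono (reaching t) p (ℕ.<⇒≤ stable<later)))) ⟨
    ∑ (λ t → (level (reaching t) stableLevel p + gap p t) * runs accepting t z)
      ≡⟨ ℕ∑.sum-cong-≗ (λ t → ℕ.*-distribʳ-+ (runs accepting t z) (level (reaching t) stableLevel p) (gap p t)) ⟩
    ∑ (λ t → level (reaching t) stableLevel p * runs accepting t z + gap p t * runs accepting t z)
      ≡⟨ ℕ∑.∑-distrib-+ (λ t → level (reaching t) stableLevel p * runs accepting t z) _ ⟩
    ∑ (λ t → level (reaching t) stableLevel p * runs accepting t z) + ∑ (λ t → gap p t * runs accepting t z)
      ≡⟨ cong (_+ ∑ (λ t → gap p t * runs accepting t z)) (level-++ accepting stableLevel p z) ⟨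
    stableCount (p ++ z) + ∑ (λ t → gap p t * runs accepting t z) ∎
    where open ≡-Reasoning

  -- For an extension `p ++ z` the growth is the pairing of `gap p` with the suffix counts, whose
  -- positivity depends on `gap p` through its support alone.
  Unbounded-class : ∀ {p p′} → class p ≡ class p′ → ∀ z → Unbounded (p ++ z) → Unbounded (p′ ++ z)
  Unbounded-class {p} {p′} eq z u =
    subst (stableCount (p′ ++ z) <_) (sym (laterLevel-++ p′ z))
      (ℕ.m<m+n _ (∑*-support {α = gap p} {gap p′} (λ t → runs accepting t z) eq
        (ℕ.+-cancelˡ-< (stableCount (p ++ z)) 0 _
          (subst₂ _<_ (sym (ℕ.+-identityʳ _)) (laterLevel-++ p z) u))))

-- Comparing two automata

pos-∑ : ∀ {n} (f : Fin n → ℕ) → ⁺ (∑ f) ≡ ∑ᶻ (λ i → ⁺ f i)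
pos-∑ {zero} f = refl
pos-∑ {suc n} f = cong (λ u → ⁺ f zero ℤ.+ u) (pos-∑ (f ∘ suc))

-- Linear functionals preserve linear relations; the proof exchanges the two sums.
relation-functional : ∀ {m n} (e : Fin m → ℤ) (X : Fin m → Fin n → ℕ) (Y : Fin n → ℕ) →
  (∀ t → ∑ᶻ (λ i → e i ℤ.* ⁺ X i t) ≡ 0ℤ) → ∑ᶻ (λ i → e i ℤ.* ⁺ ∑ (λ t → X i t * Y t)) ≡ 0ℤ
relation-functional e X Y rel = begin
  ∑ᶻ (λ i → e i ℤ.* ⁺ ∑ (λ t → X i t * Y t))
    ≡⟨ ℤ∑.sum-cong-≗ (λ i → trans (cong (e i ℤ.*_) (pos-∑ (λ t → X i t * Y t)))
                                    (ℤ∑.*-distribˡ-sum (e i) (λ t → ⁺ (X i t * Y t)))) ⟩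
  ∑ᶻ (λ i → ∑ᶻ (λ t → e i ℤ.* ⁺ (X i t * Y t)))
    ≡⟨ ℤ∑.∑-comm (λ i t → e i ℤ.* ⁺ (X i t * Y t)) ⟩
  ∑ᶻ (λ t → ∑ᶻ (λ i → e i ℤ.* ⁺ (X i t * Y t)))
    ≡⟨ ∑ᶻ-zero (λ t → begin
      ∑ᶻ (λ i → e i ℤ.* ⁺ (X i t * Y t))
        ≡⟨ ℤ∑.sum-cong-≗ (λ i → trans (cong (e i ℤ.*_) (ℤ.pos-* (X i t) (Y t))) (sym (ℤ.*-assoc (e i) (⁺ X i t) (⁺ Y t)))) ⟩
      ∑ᶻ (λ i → e i ℤ.* ⁺ X i t ℤ.* ⁺ Y t)
        ≡⟨ ℤ∑.*-distribʳ-sum (⁺ Y t) (λ i → e i ℤ.* ⁺ X i t) ⟨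
      ∑ᶻ (λ i → e i ℤ.* ⁺ X i t) ℤ.* ⁺ Y t
        ≡⟨ cong (ℤ._* ⁺ Y t) (rel t) ⟩
      0ℤ ℤ.* ⁺ Y t
        ≡⟨ ℤ.*-zeroˡ (⁺ Y t) ⟩
      0ℤ ∎) ⟩
  0ℤ ∎
  where open ≡-Reasoning

all-words≤? : ∀ L {P : List Bool → Set} → (∀ w → Dec (P w)) → Dec (∀ w → length w ≤ L → P w)
all-words≤? zero {P} P? = map′ (λ p → λ { [] _ → p }) (λ ∀p → ∀p [] z≤n) (P? [])
all-words≤? (suc L) {P} P? =
  map′ (λ { (p , p₀ , p₁) → λ { [] _ → p ; (false ∷ w) (s≤s w≤L) → p₀ w w≤L ; (true ∷ w) (s≤s w≤L) → p₁ w w≤L } })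
       (λ ∀p → ∀p [] z≤n , (λ w w≤L → ∀p (false ∷ w) (s≤s w≤L)) , (λ w w≤L → ∀p (true ∷ w) (s≤s w≤L)))
       (P? [] ×-dec all-words≤? L (P? ∘ (false ∷_)) ×-dec all-words≤? L (P? ∘ (true ∷_)))

length-take-drop : ∀ {i j} (w : List Bool) → i < j → j ≤ length w → length (take i w ++ drop j w) < length w
length-take-drop {i} {j} w i<j j≤w = begin-strict
  length (take i w ++ drop j w)           ≡⟨ length-++ (take i w) ⟩
  length (take i w) + length (drop j w)   ≡⟨ cong₂ _+_ (length-take i w) (length-drop j w) ⟩
  i ℕ.⊓ length w + (length w ∸ j)         ≤⟨ ℕ.+-monoˡ-≤ _ (ℕ.m⊓n≤m i (length w)) ⟩
  i + (length w ∸ j)                      <⟨ ℕ.+-monoˡ-< _ i<j ⟩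
  j + (length w ∸ j)                      ≡⟨ ℕ.m+[n∸m]≡n j≤w ⟩
  length w                                ∎
  where open ℕ.≤-Reasoning

module Comparison
  (M₁ : DFA) (loop₁ : DFA.step M₁ (DFA.start M₁) (false , false) ≡ DFA.start M₁)
  (M₂ : DFA) (loop₂ : DFA.step M₂ (DFA.start M₂) (false , false) ≡ DFA.start M₂) where

  module A = Runs M₁ loop₁
  module B = Runs M₂ loop₂

  -- A decidable form of equality of the two suprema: both infinite, or both finite and attained at
  -- the respective stable levels.
  Agree : List Bool → Set
  Agree w = (A.Unbounded w → B.Unbounded w) × (B.Unbounded w → A.Unbounded w) ×
            (¬ A.Unbounded w → A.stableCount w ≡ B.stableCount w)

  agree? : ∀ w → Dec (Agree w)
  agree? w = (A? →-dec B?) ×-dec (B? →-dec A?) ×-dec (¬? A? →-dec (A.stableCount w ℕ.≟ B.stableCount w))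
    where
    A? = A.stableCount w ℕ.<? A.level A.accepting A.laterLevel w
    B? = B.stableCount w ℕ.<? B.level B.accepting B.laterLevel w

  Class Entry : Set
  Class = Fin (2 ^ DFA.nStates M₁) × Fin (2 ^ DFA.nStates M₂)
  Entry = Maybe (Fin (DFA.nStates M₁) ⊎ Fin (DFA.nStates M₂))

  class : List Bool → Class
  class p = A.class p , B.class p

  _≟ᶜ_ : (c d : Class) → Dec (c ≡ d)
  _≟ᶜ_ = ≡-dec Fin._≟_ Fin._≟_

  χ : Class → Class → ℤ
  χ c d = ⁺ iverson (c ≟ᶜ d)

  entry : List Bool → Entry → ℤ
  entry p nothing = 1ℤ
  entry p (just (inj₁ t)) = ⁺ A.level (A.reaching t) A.stableLevel p
  entry p (just (inj₂ t)) = ⁺ B.level (B.reaching t) B.stableLevel p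

  -- The entries are placed in the block belonging to the class of the prefix. A relation among
  -- vectors therefore restricts, block by block, to relations among prefixes of one class.
  vector : List Bool → Class × Entry → ℤ
  vector p (d , κ) = χ (class p) d ℤ.* entry p κ

  classes : List Class
  classes = cartesianProduct (allFin _) (allFin _)

  entries : List Entry
  entries = nothing ∷ map just (map inj₁ (allFin _) ++ map inj₂ (allFin _))

  coordinates : List (Class × Entry)
  coordinates = cartesianProduct classes entries

  ∈-coordinates : ∀ x → x ∈ coordinates
  ∈-coordinates ((c , d) , κ) =
    ∈-cartesianProduct⁺ (∈-cartesianProduct⁺ (∈-allFin c) (∈-allFin d)) (∈-entries κ)
    where
    ∈-entries : ∀ κ → κ ∈ entries
    ∈-entries nothing = here refl
    ∈-entries (just (inj₁ t)) = there (∈-map⁺ just (∈-++⁺ˡ (∈-map⁺ inj₁ (∈-allFin t))))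
    ∈-entries (just (inj₂ t)) = there (∈-map⁺ just (∈-++⁺ʳ (map inj₁ (allFin _)) (∈-map⁺ inj₂ (∈-allFin t))))

  bound : ℕ
  bound = length coordinates

  module LongWord (w : List Bool) (bound≤w : bound ≤ length w)
    (shorter-agree : ∀ v → length v < length w → Agree v)
    (c : Fin (suc bound) → ℤ) (l : Fin (suc bound)) (c-l≢0 : c l ≢ 0ℤ) (c-after : ∀ j → l Fin.< j → c j ≡ 0ℤ)
    (relation : ∀ {x} → x ∈ coordinates → ∑ᶻ (λ i → c i ℤ.* vector (take (toℕ i) w) x) ≡ 0ℤ) where

    prefix : Fin (suc bound) → List Bool
    prefix i = take (toℕ i) w

    suffix : List Bool
    suffix = drop (toℕ l) w

    prefix-suffix : prefix l ++ suffix ≡ w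
    prefix-suffix = take++drop≡id (toℕ l) w

    -- The relation `c` read in the block of `class (prefix l)`: prefixes of other classes get
    -- coefficient 0.
    e : Fin (suc bound) → ℤ
    e i = c i ℤ.* χ (class (prefix i)) (class (prefix l))

    e-l≢0 : e l ≢ 0ℤ
    e-l≢0 e≡0 = c-l≢0 (trans (sym (ℤ.*-identityʳ (c l)))
      (trans (cong (λ n → c l ℤ.* ⁺ n) (sym (iverson-yes (class (prefix l) ≟ᶜ class (prefix l)) refl))) e≡0))

    e-relation : ∀ κ → ∑ᶻ (λ i → e i ℤ.* entry (prefix i) κ) ≡ 0ℤ
    e-relation κ = trans (ℤ∑.sum-cong-≗ (λ i → ℤ.*-assoc (c i) (χ (class (prefix i)) (class (prefix l))) (entry (prefix i) κ)))
                         (relation (∈-coordinates (class (prefix l) , κ)))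

    e-stableA : ∑ᶻ (λ i → e i ℤ.* ⁺ A.stableCount (prefix i ++ suffix)) ≡ 0ℤ
    e-stableA = trans (ℤ∑.sum-cong-≗ (λ i → cong (λ n → e i ℤ.* ⁺ n) (A.level-++ A.accepting A.stableLevel (prefix i) suffix)))
      (relation-functional e (λ i t → A.level (A.reaching t) A.stableLevel (prefix i)) (λ t → A.runs A.accepting t suffix)
        (λ t → e-relation (just (inj₁ t))))

    e-stableB : ∑ᶻ (λ i → e i ℤ.* ⁺ B.stableCount (prefix i ++ suffix)) ≡ 0ℤ
    e-stableB = trans (ℤ∑.sum-cong-≗ (λ i → cong (λ n → e i ℤ.* ⁺ n) (B.level-++ B.accepting B.stableLevel (prefix i) suffix)))
      (relation-functional e (λ i t → B.level (B.reaching t) B.stableLevel (prefix i)) (λ t → B.runs B.accepting t suffix)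
        (λ t → e-relation (just (inj₂ t))))

    same-class : ∀ i → e i ≢ 0ℤ → class (prefix i) ≡ class (prefix l)
    same-class i e≢0 = decidable-stable (class (prefix i) ≟ᶜ class (prefix l))
      (λ c≢ → e≢0 (trans (cong (λ n → c i ℤ.* ⁺ n) (iverson-no (class (prefix i) ≟ᶜ class (prefix l)) c≢)) (ℤ.*-zeroʳ (c i))))

    other-agrees : ∀ i → i ≢ l → e i ≢ 0ℤ → Agree (prefix i ++ suffix)
    other-agrees i i≢l e≢0 with Fin.<-cmp i l
    -- Replacing `prefix l` by the shorter `prefix i` cuts a nonempty factor out of `w`, so the
    -- hypothesis on shorter words applies.
    ... | tri< i<l _ _ = shorter-agree _ (length-take-drop w i<l (ℕ.≤-trans (Fin.toℕ≤pred[n] l) bound≤w))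
    ... | tri≈ _ i≡l _ = contradiction i≡l i≢l
    ... | tri> _ _ l<i = contradiction
      (trans (cong (ℤ._* χ (class (prefix i)) (class (prefix l))) (c-after i l<i)) (ℤ.*-zeroˡ (χ (class (prefix i)) (class (prefix l)))))
      e≢0

    -- The entry `nothing` is constantly 1, so the relation must involve an earlier prefix of the same class.
    witness : ∃ λ i → i ≢ l × e i ≢ 0ℤ
    witness with Fin.any? (λ i → ¬? (i Fin.≟ l) ×-dec ¬? (e i ℤ.≟ 0ℤ))
    ... | yes found = found
    ... | no none = contradiction
      (∑ᶻ-cancel {f = e} {λ _ → 0ℤ} l
        (trans (ℤ∑.sum-cong-≗ (λ i → sym (ℤ.*-identityʳ (e i))))
               (trans (e-relation nothing) (sym (∑ᶻ-zero {suc bound} (λ _ → refl)))))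
        (λ i i≢l → decidable-stable (e i ℤ.≟ 0ℤ) (λ e≢0 → none (i , i≢l , e≢0))))
      e-l≢0

    A-from : ∀ i → e i ≢ 0ℤ → A.Unbounded (prefix i ++ suffix) → A.Unbounded w
    A-from i e≢0 u = subst A.Unbounded prefix-suffix (A.Unbounded-class (cong proj₁ (same-class i e≢0)) suffix u)

    A-to : ∀ i → e i ≢ 0ℤ → A.Unbounded w → A.Unbounded (prefix i ++ suffix)
    A-to i e≢0 u = A.Unbounded-class (cong proj₁ (sym (same-class i e≢0))) suffix (subst A.Unbounded (sym prefix-suffix) u)

    B-from : ∀ i → e i ≢ 0ℤ → B.Unbounded (prefix i ++ suffix) → B.Unbounded w
    B-from i e≢0 u = subst B.Unbounded prefix-suffix (B.Unbounded-class (cong proj₂ (same-class i e≢0)) suffix u)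

    B-to : ∀ i → e i ≢ 0ℤ → B.Unbounded w → B.Unbounded (prefix i ++ suffix)
    B-to i e≢0 u = B.Unbounded-class (cong proj₂ (sym (same-class i e≢0))) suffix (subst B.Unbounded (sym prefix-suffix) u)

    stableCounts-equal : ¬ A.Unbounded w → A.stableCount w ≡ B.stableCount w
    stableCounts-equal ¬u = subst (λ v → A.stableCount v ≡ B.stableCount v) prefix-suffix
      -- Both families of counts satisfy the relation `e` and agree in every term other than `l`,
      -- hence also in the term `l`, where the nonzero `e l` cancels.
      (ℤ.+-injective (ℤ.*-cancelˡ-≡ (e l) _ _ {{ℤ.≢-nonZero e-l≢0}}
        (∑ᶻ-cancel {f = λ i → e i ℤ.* ⁺ A.stableCount (prefix i ++ suffix)}
                   {λ i → e i ℤ.* ⁺ B.stableCount (prefix i ++ suffix)} l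
          (trans e-stableA (sym e-stableB)) other-terms)))
      where
      other-terms : ∀ i → i ≢ l → e i ℤ.* ⁺ A.stableCount (prefix i ++ suffix) ≡ e i ℤ.* ⁺ B.stableCount (prefix i ++ suffix)
      other-terms i i≢l with e i ℤ.≟ 0ℤ
      ... | yes e≡0 = trans (cong (ℤ._* ⁺ A.stableCount (prefix i ++ suffix)) e≡0) (sym (cong (ℤ._* ⁺ B.stableCount (prefix i ++ suffix)) e≡0))
      ... | no e≢0 = cong (λ n → e i ℤ.* ⁺ n) (proj₂ (proj₂ (other-agrees i i≢l e≢0)) (¬u ∘ A-from i e≢0))

    agree : Agree w
    agree with witness
    ... | i , i≢l , e≢0 with other-agrees i i≢l e≢0
    ... | A⇒B , B⇒A , _ = B-from i e≢0 ∘ A⇒B ∘ A-to i e≢0 , A-from i e≢0 ∘ B⇒A ∘ B-to i e≢0 , stableCounts-equal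

  agree-everywhere : (∀ w → length w ≤ bound → Agree w) → ∀ w → Agree w
  agree-everywhere short w = go w (<-wellFounded (length w))
    where
    go : ∀ w → Acc _<_ (length w) → Agree w
    go w (acc rec) with ℕ.≤-total (length w) bound
    ... | inj₁ w≤bound = short w w≤bound
    ... | inj₂ bound≤w =
      let c , l , c-l≢0 , c-after , relation =
            -- The prefixes of lengths 0 to `bound` are one more than the coordinates, which forces
            -- a dependence.
            last-dependent coordinates {suc bound} (λ i → vector (take (toℕ i) w)) (ℕ.n<1+n bound)
      in LongWord.agree w bound≤w (λ v v<w → go v (rec v<w)) c l c-l≢0 c-after relation

  -- Equality of the two suprema of levels, phrased without reference to the chosen levels so that
  -- it can be compared with `_≼_`.
  Dominated : List Bool → Set
  Dominated w =
    (∀ k → ∃ λ k′ → A.level A.accepting k w ≤ B.level B.accepting k′ w) ×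
    (∀ k → ∃ λ k′ → B.level B.accepting k w ≤ A.level A.accepting k′ w)

  Agree⇒Dominated : ∀ w → Agree w → Dominated w
  Agree⇒Dominated w (A⇒B , B⇒A , stable) with A.stableCount w ℕ.<? A.level A.accepting A.laterLevel w
  ... | yes u = (λ k → B.Unbounded⇒unbounded w (A⇒B u) _) , (λ k → A.Unbounded⇒unbounded w u _)
  ... | no ¬u =
    (λ k → B.stableLevel , ℕ.≤-trans (A.¬Unbounded⇒bounded w ¬u k) (ℕ.≤-reflexive (stable ¬u))) ,
    (λ k → A.stableLevel , ℕ.≤-trans (B.¬Unbounded⇒bounded w (¬u ∘ B⇒A) k) (ℕ.≤-reflexive (sym (stable ¬u))))

  Dominated⇒Agree : ∀ w → Dominated w → Agree w
  Dominated⇒Agree w (A≤B , B≤A) = A⇒B , B⇒A , stable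
    where
    A⇒B : A.Unbounded w → B.Unbounded w
    A⇒B u = decidable-stable (B.stableCount w ℕ.<? B.level B.accepting B.laterLevel w) λ ¬u →
      let k , large = A.Unbounded⇒unbounded w u (suc (B.stableCount w))
          k′ , A≤ = A≤B k
      in ℕ.<-irrefl refl (ℕ.≤-trans large (ℕ.≤-trans A≤ (B.¬Unbounded⇒bounded w ¬u k′)))
    B⇒A : B.Unbounded w → A.Unbounded w
    B⇒A u = decidable-stable (A.stableCount w ℕ.<? A.level A.accepting A.laterLevel w) λ ¬u →
      let k , large = B.Unbounded⇒unbounded w u (suc (A.stableCount w))
          k′ , B≤ = B≤A k
      in ℕ.<-irrefl refl (ℕ.≤-trans large (ℕ.≤-trans B≤ (A.¬Unbounded⇒bounded w ¬u k′)))
    stable : ¬ A.Unbounded w → A.stableCount w ≡ B.stableCount w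
    stable ¬u = ℕ.≤-antisym
      (let k′ , A≤ = A≤B A.stableLevel in ℕ.≤-trans A≤ (B.¬Unbounded⇒bounded w (¬u ∘ B⇒A) k′))
      (let k′ , B≤ = B≤A B.stableLevel in ℕ.≤-trans B≤ (A.¬Unbounded⇒bounded w ¬u k′))

  abstract
    -- The finite test runs on `Agree` for words of length at most `bound`; `agree-everywhere`
    -- extends a positive answer to all words.
    dominated? : Dec (∀ w → Dominated w)
    dominated? = map′ (λ short w → Agree⇒Dominated w (agree-everywhere short w))
                      (λ dom w _ → Dominated⇒Agree w (dom w))
                      (all-words≤? bound agree?)

-- Zeckendorf representations

noConsec11? : ∀ w → Dec (NoConsec11 w)
noConsec11? [] = yes tt
noConsec11? (false ∷ w) = noConsec11? w
noConsec11? (true ∷ []) = yes tt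
noConsec11? (true ∷ false ∷ w) = noConsec11? w
noConsec11? (true ∷ true ∷ w) = no λ ()

fib-suc-pos : ∀ n → 0 < fib (suc n)
fib-suc-pos zero = s≤s z≤n
fib-suc-pos (suc n) = ℕ.≤-trans (fib-suc-pos n) (ℕ.m≤m+n _ _)

n≤fib[n+2] : ∀ n → n ≤ fib (n + 2)
n≤fib[n+2] zero = z≤n
n≤fib[n+2] (suc n) = begin
  suc n                        ≡⟨ ℕ.+-comm 1 n ⟩
  n + 1                        ≤⟨ ℕ.+-mono-≤ (n≤fib[n+2] n) (fib-suc-pos n) ⟩
  fib (n + 2) + fib (suc n)    ≡⟨ cong (λ m → fib m + fib (suc n)) (ℕ.+-comm n 2) ⟩
  fib (suc (2 + n))            ≡⟨ cong (fib ∘ suc) (ℕ.+-comm 2 n) ⟩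
  fib (suc n + 2)              ∎
  where open ℕ.≤-Reasoning

Representable : ℕ → ℕ → Set
Representable m n = ∃ λ w → NoConsec11 w × length w ≡ m × fibVal w ≡ n

greedy-step : ∀ m → (∀ n → n < fib (suc m + 2) → Representable (suc m) n) →
  (∀ n → n < fib (m + 2) → Representable m n) → ∀ n → n < fib (2 + m + 2) → Representable (2 + m) n
greedy-step m rep₁ rep₀ n n<fib with ℕ.<-≤-connex n (fib (suc m + 2))
... | inj₁ n<F = let w , ok , len , val = rep₁ n n<F in false ∷ w , ok , cong suc len , val
... | inj₂ F≤n =
  -- The greedy choice takes the leading 1; the remainder lies below `fib (m + 2)`, so the next
  -- digit can be 0 and no 11 arises.
  let F = fib (suc m + 2)
      w , ok , len , val = rep₀ (n ∸ F)
        (ℕ.+-cancelˡ-< F _ _ (subst (_< F + fib (m + 2)) (sym (ℕ.m+[n∸m]≡n F≤n)) n<fib))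
  in true ∷ false ∷ w , ok , cong (2 +_) len ,
     trans (cong₂ (λ l v → fib (suc l + 2) + v) len val) (ℕ.m+[n∸m]≡n F≤n)

zeckendorf : ∀ m n → n < fib (m + 2) → Representable m n
zeckendorf zero zero _ = [] , tt , refl , refl
zeckendorf zero (suc n) (s≤s ())
zeckendorf (suc zero) zero _ = false ∷ [] , tt , refl , refl
zeckendorf (suc zero) (suc zero) _ = true ∷ [] , tt , refl , refl
zeckendorf (suc zero) (suc (suc n)) (s≤s (s≤s ()))
zeckendorf (suc (suc m)) = greedy-step m (zeckendorf (suc m)) (zeckendorf m)

sumWords : ℕ → (List Bool → ℕ) → ℕ
sumWords zero f = f []
sumWords (suc m) f = sumWords m (f ∘ (false ∷_)) + sumWords m (f ∘ (true ∷_))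

sumWords-zero : ∀ m f → (∀ u → length u ≡ m → f u ≡ 0) → sumWords m f ≡ 0
sumWords-zero zero f f≗0 = f≗0 [] refl
sumWords-zero (suc m) f f≗0 =
  cong₂ _+_ (sumWords-zero m _ (λ u len → f≗0 (false ∷ u) (cong suc len)))
            (sumWords-zero m _ (λ u len → f≗0 (true ∷ u) (cong suc len)))

-- Words of length m without 11 enumerate the numbers below F_{m+2}; they begin with 0 or 10.
sumWords-fib : ∀ m f g → (∀ u → length u ≡ m → NoConsec11 u → f u ≡ g (fibVal u)) →
  (∀ u → length u ≡ m → ¬ NoConsec11 u → f u ≡ 0) → sumWords m f ≡ sumBelow (fib (m + 2)) g
sumWords-fib zero f g valid invalid = valid [] refl tt
sumWords-fib (suc zero) f g valid invalid = cong₂ _+_ (valid (false ∷ []) refl tt) (valid (true ∷ []) refl tt)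
sumWords-fib (suc (suc m)) f g valid invalid = begin
  sumWords (suc m) (f ∘ (false ∷_)) + (sumWords m (λ u → f (true ∷ false ∷ u)) + sumWords m (λ u → f (true ∷ true ∷ u)))
    ≡⟨ cong₂ _+_
         (sumWords-fib (suc m) (f ∘ (false ∷_)) g (λ u len → valid (false ∷ u) (cong suc len)) (λ u len → invalid (false ∷ u) (cong suc len)))
         (cong₂ _+_
           (sumWords-fib m (λ u → f (true ∷ false ∷ u)) (λ n → g (F + n))
             (λ u len ok → trans (valid (true ∷ false ∷ u) (cong (2 +_) len) ok) (cong (λ l → g (fib (suc l + 2) + fibVal u)) len))
             (λ u len → invalid (true ∷ false ∷ u) (cong (2 +_) len)))
           (sumWords-zero m _ (λ u len → invalid (true ∷ true ∷ u) (cong (2 +_) len) (λ ())))) ⟩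
  sumBelow F g + (sumBelow (fib (m + 2)) (λ n → g (F + n)) + 0)
    ≡⟨ cong (sumBelow F g +_) (ℕ.+-identityʳ _) ⟩
  sumBelow F g + sumBelow (fib (m + 2)) (λ n → g (F + n))
    ≡⟨ sumBelow-+ F (fib (m + 2)) g ⟨
  sumBelow (fib (suc (suc m) + 2)) g ∎
  where
  open ≡-Reasoning
  F = fib (suc m + 2)

strip : List Bool → List Bool
strip [] = []
strip (false ∷ w) = strip w
strip (true ∷ w) = true ∷ w

length-strip : ∀ w → length (strip w) ≤ length w
length-strip [] = z≤n
length-strip (false ∷ w) = ℕ.m≤n⇒m≤1+n (length-strip w)
length-strip (true ∷ w) = ℕ.≤-refl

strip-isZeck : ∀ w → NoConsec11 w → IsZeck (strip w) (fibVal w)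
strip-isZeck [] ok = tt , tt , refl
strip-isZeck (false ∷ w) ok = strip-isZeck w ok
strip-isZeck (true ∷ w) ok = tt , ok , refl

padTo-strip : ∀ w → padTo (length w) (strip w) ≡ w
padTo-strip [] = refl
padTo-strip (false ∷ w) =
  trans (cong (λ k → replicate k false ++ strip w) (ℕ.+-∸-assoc 1 (length-strip w))) (cong (false ∷_) (padTo-strip w))
padTo-strip (true ∷ w) = cong (λ k → replicate k false ++ true ∷ w) (ℕ.n∸n≡0 (length w))

pairUp-strip : ∀ u w → length u ≡ length w → length (strip u) ⊔ length (strip w) ≡ length w →
  pairUp (strip u) (strip w) ≡ zip u w
pairUp-strip u w u≡w max≡w = cong₂ zip
  (trans (cong (λ k → padTo k (strip u)) (trans max≡w (sym u≡w))) (padTo-strip u))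
  (trans (cong (λ k → padTo k (strip w)) max≡w) (padTo-strip w))

-- Normalised automata

-- `init` means that only pairs of zeros have been read, `dead` that one component has shown 11, and
-- `run q c d` keeps the original state together with the last pair of digits.
data State (n : ℕ) : Set where
  init dead : State n
  run : Fin n → Bool → Bool → State n

open Inverse Fin.2↔Bool using () renaming (to to toBool; from to fromBool)

encode : ∀ {n} → State n → Fin (2 + n * (2 * 2))
encode init = zero
encode dead = suc zero
encode (run q c d) = suc (suc (combine q (combine (fromBool c) (fromBool d))))

unpack : ∀ {n} → Fin n × Fin (2 * 2) → State n
unpack (q , r) = let c , d = remQuot {2} 2 r in run q (toBool c) (toBool d)

decode : ∀ {n} → Fin (2 + n * (2 * 2)) → State n
decode zero = init
decode (suc zero) = dead
decode (suc (suc k)) = unpack (remQuot (2 * 2) k)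

decode-encode : ∀ {n} (s : State n) → decode (encode s) ≡ s
decode-encode init = refl
decode-encode dead = refl
decode-encode (run q c d) =
  trans (cong unpack (Fin.remQuot-combine q (combine (fromBool c) (fromBool d)))) (unpack-combine c d)
  where
  unpack-combine : ∀ c d → unpack (q , combine (fromBool c) (fromBool d)) ≡ run q c d
  unpack-combine false false = refl
  unpack-combine false true = refl
  unpack-combine true false = refl
  unpack-combine true true = refl

module Normalisation (A : DFA) where
  open DFA A

  δ : State nStates → Bool × Bool → State nStates
  δ init (false , false) = init
  δ init (c , d) = run (step start (c , d)) c d
  δ dead _ = dead
  δ (run q c d) (c′ , d′) = if (c ∧ c′) ∨ (d ∧ d′) then dead else run (step q (c′ , d′)) c′ d′

  isFinal : State nStates → Bool
  isFinal init = final start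
  isFinal dead = false
  isFinal (run q _ _) = final q

  normalise : DFA
  normalise = record
    { nStates = 2 + nStates * (2 * 2)
    ; start = encode {nStates} init
    ; step = λ s x → encode (δ (decode s) x)
    ; final = λ s → isFinal (decode s)
    }

  open Runs normalise refl public

  acceptsFrom : State nStates → List (Bool × Bool) → Bool
  acceptsFrom s ps = isFinal (foldl δ s ps)

  runs-sumWords : ∀ s w → runs accepting (encode s) w ≡
    sumWords (length w) (λ u → if acceptsFrom s (zip u w) then 1 else 0)
  runs-sumWords s [] = cong (λ t → if isFinal t then 1 else 0) (decode-encode s)
  runs-sumWords s (b ∷ w) rewrite decode-encode s =
    cong₂ _+_ (runs-sumWords (δ s (false , b)) w) (runs-sumWords (δ s (true , b)) w)

  dead-rejects : ∀ ps → acceptsFrom dead ps ≡ false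
  dead-rejects [] = refl
  dead-rejects (_ ∷ ps) = dead-rejects ps

  -- Prepending the remembered digits `c` and `d` covers a 11 that straddles the part already read
  -- and the rest.
  run-valid : ∀ q c d u w → NoConsec11 (c ∷ u) → NoConsec11 (d ∷ w) →
    acceptsFrom (run q c d) (zip u w) ≡ final (foldl step q (zip u w))
  run-valid q c d [] w _ _ = refl
  run-valid q c d (c′ ∷ u) [] _ _ = refl
  run-valid q false false (c′ ∷ u) (d′ ∷ w) okᵘ okʷ = run-valid _ c′ d′ u w okᵘ okʷ
  run-valid q false true (c′ ∷ u) (false ∷ w) okᵘ okʷ = run-valid _ c′ false u w okᵘ okʷ
  run-valid q true false (false ∷ u) (d′ ∷ w) okᵘ okʷ = run-valid _ false d′ u w okᵘ okʷ
  run-valid q true true (false ∷ u) (false ∷ w) okᵘ okʷ = run-valid _ false false u w okᵘ okʷ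

  run-invalidᵘ : ∀ q c d u w → length u ≡ length w → ¬ NoConsec11 (c ∷ u) → acceptsFrom (run q c d) (zip u w) ≡ false
  run-invalidᵘ q false d [] w _ bad = contradiction tt bad
  run-invalidᵘ q true d [] w _ bad = contradiction tt bad
  run-invalidᵘ q false false (c′ ∷ u) (d′ ∷ w) len bad = run-invalidᵘ _ c′ d′ u w (ℕ.suc-injective len) bad
  run-invalidᵘ q false true (c′ ∷ u) (false ∷ w) len bad = run-invalidᵘ _ c′ false u w (ℕ.suc-injective len) bad
  run-invalidᵘ q false true (c′ ∷ u) (true ∷ w) len bad = dead-rejects (zip u w)
  run-invalidᵘ q true d (true ∷ u) (d′ ∷ w) len bad = dead-rejects (zip u w)
  run-invalidᵘ q true false (false ∷ u) (d′ ∷ w) len bad = run-invalidᵘ _ false d′ u w (ℕ.suc-injective len) bad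
  run-invalidᵘ q true true (false ∷ u) (false ∷ w) len bad = run-invalidᵘ _ false false u w (ℕ.suc-injective len) bad
  run-invalidᵘ q true true (false ∷ u) (true ∷ w) len bad = dead-rejects (zip u w)

  run-invalidʷ : ∀ q c d u w → length u ≡ length w → ¬ NoConsec11 (d ∷ w) → acceptsFrom (run q c d) (zip u w) ≡ false
  run-invalidʷ q c false u [] _ bad = contradiction tt bad
  run-invalidʷ q c true u [] _ bad = contradiction tt bad
  run-invalidʷ q false false (c′ ∷ u) (d′ ∷ w) len bad = run-invalidʷ _ c′ d′ u w (ℕ.suc-injective len) bad
  run-invalidʷ q false true (c′ ∷ u) (false ∷ w) len bad = run-invalidʷ _ c′ false u w (ℕ.suc-injective len) bad
  run-invalidʷ q false true (c′ ∷ u) (true ∷ w) len bad = dead-rejects (zip u w)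
  run-invalidʷ q true d (true ∷ u) (d′ ∷ w) len bad = dead-rejects (zip u w)
  run-invalidʷ q true false (false ∷ u) (d′ ∷ w) len bad = run-invalidʷ _ false d′ u w (ℕ.suc-injective len) bad
  run-invalidʷ q true true (false ∷ u) (false ∷ w) len bad = run-invalidʷ _ false false u w (ℕ.suc-injective len) bad
  run-invalidʷ q true true (false ∷ u) (true ∷ w) len bad = dead-rejects (zip u w)

  init-invalidᵘ : ∀ u w → length u ≡ length w → ¬ NoConsec11 u → acceptsFrom init (zip u w) ≡ false
  init-invalidᵘ [] w _ bad = contradiction tt bad
  init-invalidᵘ (false ∷ u) (false ∷ w) len bad = init-invalidᵘ u w (ℕ.suc-injective len) bad
  init-invalidᵘ (false ∷ u) (true ∷ w) len bad = run-invalidᵘ _ false true u w (ℕ.suc-injective len) bad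
  init-invalidᵘ (true ∷ u) (d ∷ w) len bad = run-invalidᵘ _ true d u w (ℕ.suc-injective len) bad

  init-invalidʷ : ∀ u w → length u ≡ length w → ¬ NoConsec11 w → acceptsFrom init (zip u w) ≡ false
  init-invalidʷ u [] _ bad = contradiction tt bad
  init-invalidʷ (false ∷ u) (false ∷ w) len bad = init-invalidʷ u w (ℕ.suc-injective len) bad
  init-invalidʷ (false ∷ u) (true ∷ w) len bad = run-invalidʷ _ false true u w (ℕ.suc-injective len) bad
  init-invalidʷ (true ∷ u) (d ∷ w) len bad = run-invalidʷ _ true d u w (ℕ.suc-injective len) bad

  -- Waiting in `init` skips the common leading zeros. The first other pair contains a 1, so one
  -- stripped word keeps the full remaining length and `pairUp` pads the other back to it.
  init-valid : ∀ u w → length u ≡ length w → NoConsec11 u → NoConsec11 w →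
    acceptsFrom init (zip u w) ≡ accepts A (pairUp (strip u) (strip w))
  init-valid [] [] _ _ _ = refl
  init-valid (false ∷ u) (false ∷ w) len okᵘ okʷ = init-valid u w (ℕ.suc-injective len) okᵘ okʷ
  init-valid (false ∷ u) (true ∷ w) len okᵘ okʷ =
    trans (run-valid _ false true u w okᵘ okʷ)
          (cong (accepts A) (sym (pairUp-strip (false ∷ u) (true ∷ w) len
            (ℕ.m≤n⇒m⊔n≡n (ℕ.≤-trans (length-strip (false ∷ u)) (ℕ.≤-reflexive len))))))
  init-valid (true ∷ u) (d ∷ w) len okᵘ okʷ =
    trans (run-valid _ true d u w okᵘ okʷ)
          (cong (accepts A) (sym (pairUp-strip (true ∷ u) (d ∷ w) len
            (trans (ℕ.m≥n⇒m⊔n≡m (ℕ.≤-trans (length-strip (d ∷ w)) (ℕ.≤-reflexive (sym len)))) len))))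

  runs-invalid : ∀ w → ¬ NoConsec11 w → runs accepting (encode {nStates} init) w ≡ 0
  runs-invalid w bad = trans (runs-sumWords init w)
    (sumWords-zero (length w) _ (λ u len → cong (if_then 1 else 0) (init-invalidʷ u w len bad)))

  level-invalid : ∀ k w → ¬ NoConsec11 w → level accepting k w ≡ 0
  level-invalid k w bad = runs-invalid (zeros k ++ w) (bad ∘ unpad k)
    where
    unpad : ∀ k → NoConsec11 (zeros k ++ w) → NoConsec11 w
    unpad zero ok = ok
    unpad (suc k) ok = unpad k ok

  module _ {a : ℕ → ℕ} (computes : Computes A a) where

    accepts-iverson : ∀ u w → NoConsec11 u → NoConsec11 w →
      (if accepts A (pairUp (strip u) (strip w)) then 1 else 0) ≡ iverson (a (fibVal u) ℕ.≟ fibVal w)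
    accepts-iverson u w okᵘ okʷ
      with accepts A (pairUp (strip u) (strip w))
         | computes (fibVal u) (fibVal w) (strip u) (strip w) (strip-isZeck u okᵘ) (strip-isZeck w okʷ)
    ... | true  | sound , _ = sym (iverson-yes (_ ℕ.≟ _) (sym (sound refl)))
    ... | false | _ , complete = sym (iverson-no (_ ℕ.≟ _) (λ eq → contradiction (complete (sym eq)) (λ ())))

    runs-occurrences : ∀ w → NoConsec11 w →
      runs accepting (encode {nStates} init) w ≡ occurrences a (fibVal w) (fib (length w + 2))
    runs-occurrences w okʷ = trans (runs-sumWords init w)
      (sumWords-fib (length w) _ (λ n → iverson (a n ℕ.≟ fibVal w))
        (λ u len okᵘ → trans (cong (if_then 1 else 0) (init-valid u w len okᵘ okʷ)) (accepts-iverson u w okᵘ okʷ))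
        (λ u len bad → cong (if_then 1 else 0) (init-invalidᵘ u w len bad)))

    level-occurrences : ∀ k w → NoConsec11 w →
      level accepting k w ≡ occurrences a (fibVal w) (fib (k + length w + 2))
    level-occurrences k w ok = trans (runs-occurrences (zeros k ++ w) (pad k))
      (cong₂ (λ x l → occurrences a x (fib (l + 2))) (fibVal-pad k)
        (trans (length-++ (zeros k)) (cong (_+ length w) (length-replicate k))))
      where
      pad : ∀ k → NoConsec11 (zeros k ++ w)
      pad zero = ok
      pad (suc k) = pad k
      fibVal-pad : ∀ k → fibVal (zeros k ++ w) ≡ fibVal w
      fibVal-pad zero = refl
      fibVal-pad (suc k) = fibVal-pad k

    -- Level `N` already reaches far enough, because `N` is at most the Fibonacci number bounding
    -- the indices counted there.
    occurrences≤level : ∀ N w → NoConsec11 w → occurrences a (fibVal w) N ≤ level accepting N w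
    occurrences≤level N w ok = ℕ.≤-trans
      (sumBelow-mono _ (ℕ.≤-trans (ℕ.m≤m+n N (length w)) (n≤fib[n+2] (N + length w))))
      (ℕ.≤-reflexive (sym (level-occurrences N w ok)))

-- From occurrence counts to levels, and the decision procedure

module _ (A B : DFA) {a b : ℕ → ℕ} (computesA : Computes A a) (computesB : Computes B b) where
  private
    module A = Normalisation A
    module B = Normalisation B

  levels⇒≼ : (∀ w k → ∃ λ k′ → A.level A.accepting k w ≤ B.level B.accepting k′ w) → a ≼ b
  -- Length `suc x` is ample: `suc x` is at most `fib (suc x + 2)`, hence `x` is strictly below it.
  levels⇒≼ dom x N with zeckendorf (suc x) x (n≤fib[n+2] (suc x))
  ... | w , ok , _ , refl =
    let k′ , le = dom w N
    in fib (k′ + length w + 2) ,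
       ℕ.≤-trans (A.occurrences≤level computesA N w ok)
         (ℕ.≤-trans le (ℕ.≤-reflexive (B.level-occurrences computesB k′ w ok)))

  ≼⇒levels : a ≼ b → ∀ w k → ∃ λ k′ → A.level A.accepting k w ≤ B.level B.accepting k′ w
  ≼⇒levels a≼b w k with noConsec11? w
  -- A word containing 11 represents no number here; all its levels are 0, so the comparison is
  -- trivial.
  ... | no bad = 0 , ℕ.≤-trans (ℕ.≤-reflexive (A.level-invalid k w bad)) z≤n
  ... | yes ok =
    let N′ , le = a≼b (fibVal w) (fib (k + length w + 2))
    in N′ , ℕ.≤-trans (ℕ.≤-reflexive (A.level-occurrences computesA k w ok))
              (ℕ.≤-trans le (B.occurrences≤level computesB N′ w ok))

theorem10 : Σ (DFA → DFA → Bool) λ decide →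
    ∀ (A B : DFA) (a b : ℕ → ℕ) → Computes A a → Computes B b →
    (decide A B ≡ true → IsPermutationOf a b) × (IsPermutationOf a b → decide A B ≡ true)
theorem10 = (λ A B → isYes (dominated A B)) , λ A B a b computesA computesB →
  (λ eq → let dom = sound A B eq in
    ≼⇒permutation (levels⇒≼ A B computesA computesB (λ w → proj₁ (dom w)))
                  (levels⇒≼ B A computesB computesA (λ w → proj₂ (dom w)))) ,
  (λ perm → let a≼b , b≼a = permutation⇒≼ perm in
    complete A B λ w → ≼⇒levels A B computesA computesB a≼b w , ≼⇒levels B A computesB computesA b≼a w)
  where
  -- The loop on `(false , false)` at the start state holds by computation, since `init` stays in
  -- `init` on a pair of zeros.
  module C (A B : DFA) = Comparison (Normalisation.normalise A) refl (Normalisation.normalise B) refl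
  dominated : ∀ A B → Dec (∀ w → C.Dominated A B w)
  dominated A B = C.dominated? A B
  sound : ∀ A B → isYes (dominated A B) ≡ true → ∀ w → C.Dominated A B w
  sound A B eq with dominated A B
  ... | yes dom = dom
  complete : ∀ A B → (∀ w → C.Dominated A B w) → isYes (dominated A B) ≡ true
  complete A B dom with dominated A B
  ... | yes _ = refl
  ... | no ¬dom = contradiction dom ¬dom
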